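{- Let $X$ be a real Hilbert space, $U:X\to X$ a nonexpansive mapping, $C\subseteq X$ a bounded closed convex set such that $U$ maps $C$ into itself, and $v_0\in C$. For each $n\in\mathbb{N}$ let $U_n(x):=\left(1-\frac{1}{n+1}\right)U(x)+\frac{1}{n+1}v_0$ and let $u_n$ be the unique fixed point of the strict contraction $U_n$. Let $b\in\mathbb{N}$, $b\geq 1$, be an upper bound on the diameter of $C$. Then, for all $k\in\mathbb{N}$ and every monotone function $f:\mathbb{N}\to\mathbb{N}$, $$\exists N\leq \phi_b(k,f)\ \forall i,j\in[N,f(N)]\ \left(\|u_i-u_j\|<\frac{1}{k+1}\right),$$ where $$\phi_b(k,f):=12b^2\left(h^{(R)}(0)+1\right)^2+b,$$ with $R:=64b^4(k+1)^4+b^2$ and $h(m):=\max\{8b(f(12b^2(m+1)^2+b)+1)(k+1)^2,\ 12b(m+1)^2\}+1$.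
   Context: $\mathbb{N}=\{0,1,2,\ldots\}$. For $n,m\in\mathbb{N}$, $[n,m]:=\{n,n+1,\ldots,m\}$ (empty if $m<n$). A map $U$ is nonexpansive if $\|U(x)-U(y)\|\leq\|x-y\|$ for all $x,y$. A function $f:\mathbb{N}\to\mathbb{N}$ is monotone if $k\leq n$ implies $f(k)\leq f(n)$. $h^{(R)}$ denotes the $R$-fold composition of $h$ with itself. -}

module Defs where

open import Level using (_⊔_; suc)
open import Algebra.Core using (Op₁; Op₂)
open import Algebra.Apartness.Structures using (IsHeytingField)
open import Algebra.Bundles using (CommutativeRing)
import Algebra.Definitions as AlgebraDefinitions
import Algebra.Definitions.RawMonoid as RawMonoidDefinitions
open import Algebra.Module.Bundles using (Module)
import Algebra.Properties.AbelianGroup as AbelianGroupProperties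
import Algebra.Properties.Ring as RingProperties
open import Data.Nat.Base as ℕ using (ℕ; zero)
open import Data.Nat.GeneralisedArithmetic using (iterate)
open import Data.Product.Base using (∃-syntax; _×_; _,_; proj₁; proj₂)
open import Data.Sum.Base using (_⊎_; inj₁; inj₂)
open import Relation.Binary.Core using (Rel)
open import Relation.Binary.Structures using (IsStrictPartialOrder)
open import Relation.Nullary.Negation using (¬_)
open import Relation.Unary using (Pred; _∈_)

-- An ordered field whose apartness is induced by its strict order.  Since
-- apartness is tight, `<` is classically a total order; totality is replaced by
-- cotransitivity so that constructively defined real numbers are covered too.
record OrderedField c ℓ₁ ℓ₂ : Set (suc (c ⊔ ℓ₁ ⊔ ℓ₂)) where
  infix  8 -_
  infixl 7 _*_
  infixl 6 _+_
  infix  4 _≈_ _<_ _≤_ _#_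
  field
    Carrier : Set c
    _≈_     : Rel Carrier ℓ₁
    _<_     : Rel Carrier ℓ₂
    _+_     : Op₂ Carrier
    _*_     : Op₂ Carrier
    -_      : Op₁ Carrier
    0#      : Carrier
    1#      : Carrier

  _#_ : Rel Carrier ℓ₂
  x # y = x < y ⊎ y < x

  _≤_ : Rel Carrier ℓ₂
  x ≤ y = ¬ (y < x)

  field
    isHeytingField       : IsHeytingField _≈_ _#_ _+_ _*_ -_ 0# 1#
    isStrictPartialOrder : IsStrictPartialOrder _≈_ _<_
    +-monoˡ-<            : ∀ z {x y} → x < y → x + z < y + z
    *-pos                : ∀ {x y} → 0# < x → 0# < y → 0# < x * y

  open IsHeytingField isHeytingField public
  open IsStrictPartialOrder isStrictPartialOrder public
    using (<-respʳ-≈; <-respˡ-≈)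
    renaming (irrefl to <-irrefl; trans to <-trans)

  commutativeRing : CommutativeRing c ℓ₁
  commutativeRing = record { isCommutativeRing = isCommutativeRing }

  private
    module R = CommutativeRing commutativeRing
    module RP = RingProperties R.ring
    module AP = AbelianGroupProperties R.+-abelianGroup

  open AlgebraDefinitions _≈_ using (Invertible)
  open RawMonoidDefinitions R.+-rawMonoid using ()
    renaming (_×_ to _·_)

  fromℕ : ℕ → Carrier
  fromℕ n = n · 1#

  x-0≈x : ∀ x → x - 0# ≈ x
  x-0≈x x = trans (+-congˡ AP.ε⁻¹≈ε) (+-identityʳ x)

  0<1 : 0# < 1#
  0<1 = positive (invertible⇒# (1# , inverseˡ , inverseʳ))
    where
    inverseˡ : 1# * (1# - 0#) ≈ 1#
    inverseˡ = trans (*-identityˡ _) (x-0≈x 1#)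

    inverseʳ : (1# - 0#) * 1# ≈ 1#
    inverseʳ = trans (*-identityʳ _) (x-0≈x 1#)

    -1*-1≈1 : (- 1#) * (- 1#) ≈ 1#
    -1*-1≈1 = trans (RP.-1*x≈-x (- 1#)) (AP.⁻¹-involutive 1#)

    positive : 1# # 0# → 0# < 1#
    positive (inj₂ 0<1) = 0<1
    positive (inj₁ 1<0) = <-respʳ-≈ -1*-1≈1 (*-pos 0<-1 0<-1)
      where
      0<-1 : 0# < - 1#
      0<-1 = <-respˡ-≈ (-‿inverseʳ 1#)
               (<-respʳ-≈ (+-identityˡ (- 1#)) (+-monoˡ-< (- 1#) 1<0))

  0<fromℕ-suc : ∀ n → 0# < fromℕ (ℕ.suc n)
  0<fromℕ-suc zero      = <-respʳ-≈ (sym (+-identityʳ 1#)) 0<1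
  0<fromℕ-suc (ℕ.suc n) = <-trans (0<fromℕ-suc n)
    (<-respˡ-≈ (+-identityˡ _) (+-monoˡ-< (fromℕ (ℕ.suc n)) 0<1))

  fromℕ-suc-invertible : ∀ n → Invertible 1# _*_ (fromℕ (ℕ.suc n))
  fromℕ-suc-invertible n with #⇒invertible (inj₂ (0<fromℕ-suc n))
  ... | y , inverseˡ , inverseʳ =
    y , trans (*-congˡ (sym (x-0≈x _))) inverseˡ
      , trans (*-congʳ (sym (x-0≈x _))) inverseʳ

  -- 1/suc n is 1 / (n + 1).
  1/suc : ℕ → Carrier
  1/suc n = proj₁ (fromℕ-suc-invertible n)

-- The real numbers are used only through the axioms of an Archimedean,
-- Cauchy-complete ordered field, which classically determine them up to
-- isomorphism.
record RealNumbers c ℓ₁ ℓ₂ : Set (suc (c ⊔ ℓ₁ ⊔ ℓ₂)) where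
  field
    orderedField : OrderedField c ℓ₁ ℓ₂

  open OrderedField orderedField public

  -- |x - y| < ε
  Within : Carrier → Carrier → Carrier → Set ℓ₂
  Within ε x y = (x - y < ε) × (y - x < ε)

  IsCauchy : (ℕ → Carrier) → Set ℓ₂
  IsCauchy s = ∀ k → ∃[ N ] (∀ i j → N ℕ.≤ i → N ℕ.≤ j → Within (1/suc k) (s i) (s j))

  ConvergesTo : (ℕ → Carrier) → Carrier → Set ℓ₂
  ConvergesTo s x = ∀ k → ∃[ N ] (∀ i → N ℕ.≤ i → Within (1/suc k) (s i) x)

  field
    archimedean : ∀ x → ∃[ n ] x < fromℕ n
    complete    : ∀ s → IsCauchy s → ∃[ x ] ConvergesTo s x

record HilbertSpace {c ℓ₁ ℓ₂} (ℝ : RealNumbers c ℓ₁ ℓ₂) m ℓm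
    : Set (c ⊔ ℓ₁ ⊔ ℓ₂ ⊔ suc (m ⊔ ℓm)) where
  private module ℝ = RealNumbers ℝ
  open ℝ using (_≈_; _<_; _≤_; _+_; _*_; 0#; 1/suc)

  field
    vectorSpace : Module ℝ.commutativeRing m ℓm

  open Module vectorSpace public

  infixl 6 _-ᴹ_
  _-ᴹ_ : Op₂ Carrierᴹ
  x -ᴹ y = x +ᴹ (-ᴹ y)

  -- ∥ x ∥ is the nonnegative square root of ⟨ x , x ⟩, which these two norm
  -- axioms determine uniquely.
  field
    ⟨_,_⟩       : Carrierᴹ → Carrierᴹ → ℝ.Carrier
    ⟨⟩-cong     : ∀ {x x′ y y′} → x ≈ᴹ x′ → y ≈ᴹ y′ → ⟨ x , y ⟩ ≈ ⟨ x′ , y′ ⟩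
    ⟨⟩-comm     : ∀ x y → ⟨ x , y ⟩ ≈ ⟨ y , x ⟩
    ⟨⟩-+ˡ       : ∀ x y z → ⟨ x +ᴹ y , z ⟩ ≈ ⟨ x , z ⟩ + ⟨ y , z ⟩
    ⟨⟩-*ˡ       : ∀ a x y → ⟨ a *ₗ x , y ⟩ ≈ a * ⟨ x , y ⟩
    ⟨⟩-nonneg   : ∀ x → 0# ≤ ⟨ x , x ⟩
    ⟨⟩-definite : ∀ x → ⟨ x , x ⟩ ≈ 0# → x ≈ᴹ 0ᴹ
    ∥_∥         : Carrierᴹ → ℝ.Carrier
    ∥∥-nonneg   : ∀ x → 0# ≤ ∥ x ∥
    ∥∥-square   : ∀ x → ∥ x ∥ * ∥ x ∥ ≈ ⟨ x , x ⟩

  IsCauchy : (ℕ → Carrierᴹ) → Set ℓ₂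
  IsCauchy s = ∀ k → ∃[ N ] (∀ i j → N ℕ.≤ i → N ℕ.≤ j → ∥ s i -ᴹ s j ∥ < 1/suc k)

  ConvergesTo : (ℕ → Carrierᴹ) → Carrierᴹ → Set ℓ₂
  ConvergesTo s x = ∀ k → ∃[ N ] (∀ i → N ℕ.≤ i → ∥ s i -ᴹ x ∥ < 1/suc k)

  field
    complete : ∀ s → IsCauchy s → ∃[ x ] ConvergesTo s x

module _ {c ℓ₁ ℓ₂ m ℓm} {ℝ : RealNumbers c ℓ₁ ℓ₂} (X : HilbertSpace ℝ m ℓm) where
  private module ℝ = RealNumbers ℝ
  open ℝ using (_<_; _≤_; _+_; _-_; 0#; 1#; 1/suc; fromℕ)
  open HilbertSpace X

  -- Nonexpansiveness forces U to respect _≈ᴹ_.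
  Nonexpansive : (Carrierᴹ → Carrierᴹ) → Set (ℓ₂ ⊔ m)
  Nonexpansive U = ∀ x y → ∥ U x -ᴹ U y ∥ ≤ ∥ x -ᴹ y ∥

  Closed : ∀ {p} → Pred Carrierᴹ p → Set (ℓ₂ ⊔ m ⊔ p)
  Closed C = ∀ x → (∀ k → ∃[ y ] (y ∈ C × ∥ x -ᴹ y ∥ < 1/suc k)) → x ∈ C

  Convex : ∀ {p} → Pred Carrierᴹ p → Set (c ⊔ ℓ₂ ⊔ m ⊔ p)
  Convex C = ∀ x y t → x ∈ C → y ∈ C → 0# ≤ t → t ≤ 1# →
             (1# - t) *ₗ x +ᴹ t *ₗ y ∈ C

  Bounded : ∀ {p} → Pred Carrierᴹ p → Set (c ⊔ ℓ₂ ⊔ m ⊔ p)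
  Bounded C = ∃[ r ] (∀ x → x ∈ C → ∥ x ∥ ≤ r)

  DiameterAtMost : ∀ {p} → ℕ → Pred Carrierᴹ p → Set (ℓ₂ ⊔ m ⊔ p)
  DiameterAtMost b C = ∀ x y → x ∈ C → y ∈ C → ∥ x -ᴹ y ∥ ≤ fromℕ b

  IsFixedPoint : (Carrierᴹ → Carrierᴹ) → Carrierᴹ → Set ℓm
  IsFixedPoint T x = T x ≈ᴹ x

  -- The contraction U_n.
  contraction : (Carrierᴹ → Carrierᴹ) → Carrierᴹ → ℕ → Carrierᴹ → Carrierᴹ
  contraction U v₀ n x = (1# - 1/suc n) *ₗ U x +ᴹ 1/suc n *ₗ v₀

module Bound (b k : ℕ) (f : ℕ → ℕ) where
  open import Data.Nat.Base using (_+_; _*_; _^_) renaming (_⊔_ to max)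

  R : ℕ
  R = 64 * b ^ 4 * (k + 1) ^ 4 + b ^ 2

  h : ℕ → ℕ
  h m = max (8 * b * (f (12 * b ^ 2 * (m + 1) ^ 2 + b) + 1) * (k + 1) ^ 2)
            (12 * b * (m + 1) ^ 2)
        + 1

  φ : ℕ
  φ = 12 * b ^ 2 * (iterate h 0 R + 1) ^ 2 + b

{-# OPTIONS --safe #-}
-- Put y n = u n - v₀ and z n = U (u n) - u n.  The fixed-point equation says
-- y n = n z n, and U - id is the negative of a monotone operator, so that
-- ⟨y i - y j, z i - z j⟩ ≤ 0.  For i < j this forces ⟨y i, y i - y j⟩ ≤ 0, hence
-- ∥u i - u j∥² ≤ ∥y j∥² - ∥y i∥²: the numbers ∥y n∥² increase, are at most b²
-- since u n lies in C, and control the distances.  Along N = 0, h 0, h (h 0), …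
-- they cannot increase by 1/((k+1)²+1) in each of R > b²((k+1)²+1) steps, and
-- f N ≤ h N, so one of the first R iterates is the required N.
module Submission where

open import Defs
open import Algebra.Bundles using (AbelianGroup; CommutativeRing; RawRing)
import Algebra.Properties.AbelianGroup as AbelianGroupProperties
import Algebra.Properties.CommutativeSemigroup as CommutativeSemigroupProperties
import Algebra.Properties.Ring as RingProperties
import Algebra.Properties.Semiring.Mult as SemiringMult
import Algebra.Solver.Ring as RingSolver
open import Algebra.Solver.Ring.AlmostCommutativeRing
  using (_-Raw-AlmostCommutative⟶_; fromCommutativeRing)
open import Data.Empty using (⊥-elim)
open import Data.Maybe.Base using (Maybe; map)
open import Data.Nat.Base as ℕ using (ℕ; zero; suc)
open import Data.Nat.GeneralisedArithmetic using (fold; iterate-is-fold)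
import Data.Nat.Properties as ℕ
open import Data.Nat.Tactic.RingSolver using (solve-∀)
open import Data.Product.Base using (∃-syntax; _×_; _,_; proj₁; proj₂)
open import Data.Product.Properties using (≡-dec)
open import Data.Sum.Base using (_⊎_; inj₁; inj₂; [_,_]′)
open import Function.Base using (_∘_; id)
open import Relation.Binary.Definitions using (Monotonic₁)
open import Relation.Binary.PropositionalEquality.Core as ≡ using (_≡_)
import Relation.Binary.Reasoning.Base.Triple as TripleReasoning
import Relation.Binary.Reasoning.Setoid as SetoidReasoning
open import Relation.Binary.Structures using (IsPreorder; IsStrictPartialOrder)
open import Relation.Nullary.Decidable.Core using (dec⇒maybe)
open import Relation.Unary using (Pred; _∈_)

-- Rearranging differences in an abelian group.

module AbelianGroupLemmas {c ℓ} (G : AbelianGroup c ℓ) where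
  open AbelianGroup G
    renaming (_∙_ to infixl 6 _+_; ∙-congˡ to +-congˡ; ∙-congʳ to +-congʳ; assoc to +-assoc; comm to +-comm)
  open AbelianGroupProperties G
  open CommutativeSemigroupProperties commutativeSemigroup using (interchange)
  open SetoidReasoning setoid

  x+w≈z+y⇒x-y≈z-w : ∀ {x y z w} → x + w ≈ z + y → x - y ≈ z - w
  x+w≈z+y⇒x-y≈z-w {x} {y} {z} {w} eq = begin
    x - y           ≈⟨ +-congʳ (//-rightDividesʳ w x) ⟨
    x + w - w - y   ≈⟨ +-congʳ (+-congʳ eq) ⟩
    z + y - w - y
      ≈⟨ +-congʳ (trans (+-assoc z y _) (trans (+-congˡ (+-comm y _)) (sym (+-assoc z _ y)))) ⟩
    z - w + y - y   ≈⟨ //-rightDividesʳ y (z - w) ⟩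
    z - w           ∎

  [x+y]-[z+w]≈[x-z]+[y-w] : ∀ x y z w → (x + y) - (z + w) ≈ (x - z) + (y - w)
  [x+y]-[z+w]≈[x-z]+[y-w] x y z w = begin
    (x + y) - (z + w)        ≈⟨ +-congˡ (⁻¹-∙-comm z w) ⟨
    (x + y) + (z ⁻¹ + w ⁻¹)  ≈⟨ interchange x y _ _ ⟩
    (x - z) + (y - w)        ∎

  [x-y]-[z-w]≈[x-z]-[y-w] : ∀ x y z w → (x - y) - (z - w) ≈ (x - z) - (y - w)
  [x-y]-[z-w]≈[x-z]-[y-w] x y z w = begin
    (x - y) - (z - w)                  ≈⟨ [x+y]-[z+w]≈[x-z]+[y-w] x _ z _ ⟩
    (x - z) + (y ⁻¹ - (w ⁻¹))          ≈⟨ +-congˡ (⁻¹-∙-comm y _) ⟩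
    (x - z) - (y - w)                  ∎

  [x+z]-[y+z]≈x-y : ∀ x y z → (x + z) - (y + z) ≈ x - y
  [x+z]-[y+z]≈x-y x y z = x+w≈z+y⇒x-y≈z-w
    (trans (+-assoc x z y) (+-congˡ (+-comm z y)))

  [x-z]-[y-z]≈x-y : ∀ x y z → (x - z) - (y - z) ≈ x - y
  [x-z]-[y-z]≈x-y x y z = [x+z]-[y+z]≈x-y x y (z ⁻¹)

-- Ring solver with integer coefficients over an arbitrary commutative ring.

-- A pair (a , b) stands for the integer a - b; each operation cancels, so that
-- one component is always 0 and equal coefficients are syntactically equal.
module IntegerCoefficientSolver {c ℓ} (R : CommutativeRing c ℓ) where
  open CommutativeRing R
  open AbelianGroupLemmas +-abelianGroup
  open AbelianGroupProperties +-abelianGroup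
  open RingProperties ring using (x[y-z]≈xy-xz; [y-z]x≈yx-zx)
  open SemiringMult semiring using (×-homo-+; ×1-homo-*) renaming (_×_ to _·_)
  open SetoidReasoning setoid

  private
    cancel : ℕ → ℕ → ℕ × ℕ
    cancel a b = a ℕ.∸ b , b ℕ.∸ a

    difference : RawRing _ _
    difference = record
      { Carrier = ℕ × ℕ
      ; _≈_     = _≡_
      ; _+_     = λ (a , b) (c , d) → cancel (a ℕ.+ c) (b ℕ.+ d)
      ; _*_     = λ (a , b) (c , d) →
                    cancel (a ℕ.* c ℕ.+ b ℕ.* d) (a ℕ.* d ℕ.+ b ℕ.* c)
      ; -_      = λ (a , b) → b , a
      ; 0#      = 0 , 0
      ; 1#      = 1 , 0
      }

    infix 9 _·1
    _·1 : ℕ → Carrier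
    n ·1 = n · 1#

    ⟦_⟧ : ℕ × ℕ → Carrier
    ⟦ a , b ⟧ = a ·1 - b ·1

    +-·1 : ∀ m n → (m ℕ.+ n) ·1 ≈ m ·1 + n ·1
    +-·1 = ×-homo-+ 1#

    ⟦cancel⟧ : ∀ a b → ⟦ cancel a b ⟧ ≈ a ·1 - b ·1
    ⟦cancel⟧ zero    zero    = refl
    ⟦cancel⟧ zero    (suc b) = refl
    ⟦cancel⟧ (suc a) zero    = refl
    ⟦cancel⟧ (suc a) (suc b) = begin
      ⟦ cancel a b ⟧                 ≈⟨ ⟦cancel⟧ a b ⟩
      a ·1 - b ·1                    ≈⟨ [x+z]-[y+z]≈x-y (a ·1) (b ·1) 1# ⟨
      (a ·1 + 1#) - (b ·1 + 1#)      ≈⟨ +-cong (+-comm _ _) (-‿cong (+-comm _ _)) ⟩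
      suc a ·1 - suc b ·1            ∎

    +-homo : ∀ a b c d → ⟦ cancel (a ℕ.+ c) (b ℕ.+ d) ⟧ ≈ ⟦ a , b ⟧ + ⟦ c , d ⟧
    +-homo a b c d = begin
      ⟦ cancel (a ℕ.+ c) (b ℕ.+ d) ⟧        ≈⟨ ⟦cancel⟧ (a ℕ.+ c) (b ℕ.+ d) ⟩
      (a ℕ.+ c) ·1 - (b ℕ.+ d) ·1           ≈⟨ +-cong (+-·1 a c) (-‿cong (+-·1 b d)) ⟩
      (a ·1 + c ·1) - (b ·1 + d ·1)         ≈⟨ [x+y]-[z+w]≈[x-z]+[y-w] _ _ _ _ ⟩
      ⟦ a , b ⟧ + ⟦ c , d ⟧                 ∎

    +*-·1 : ∀ a b c d → (a ℕ.* b ℕ.+ c ℕ.* d) ·1 ≈ a ·1 * b ·1 + c ·1 * d ·1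
    +*-·1 a b c d = trans (+-·1 (a ℕ.* b) (c ℕ.* d)) (+-cong (×1-homo-* a b) (×1-homo-* c d))

    *-homo : ∀ a b c d → ⟦ cancel (a ℕ.* c ℕ.+ b ℕ.* d) (a ℕ.* d ℕ.+ b ℕ.* c) ⟧ ≈ ⟦ a , b ⟧ * ⟦ c , d ⟧
    *-homo a b c d = begin
      ⟦ cancel (a ℕ.* c ℕ.+ b ℕ.* d) (a ℕ.* d ℕ.+ b ℕ.* c) ⟧
        ≈⟨ ⟦cancel⟧ (a ℕ.* c ℕ.+ b ℕ.* d) (a ℕ.* d ℕ.+ b ℕ.* c) ⟩
      (a ℕ.* c ℕ.+ b ℕ.* d) ·1 - (a ℕ.* d ℕ.+ b ℕ.* c) ·1
        ≈⟨ +-cong (+*-·1 a c b d) (-‿cong (+*-·1 a d b c)) ⟩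
      (a ·1 * c ·1 + b ·1 * d ·1) - (a ·1 * d ·1 + b ·1 * c ·1)
        ≈⟨ [x+y]-[z+w]≈[x-z]+[y-w] _ _ _ _ ⟩
      (a ·1 * c ·1 - a ·1 * d ·1) + (b ·1 * d ·1 - b ·1 * c ·1)
        ≈⟨ +-congˡ (⁻¹-anti-homo‿- _ _) ⟨
      (a ·1 * c ·1 - a ·1 * d ·1) - (b ·1 * c ·1 - b ·1 * d ·1)
        ≈⟨ +-cong (x[y-z]≈xy-xz _ _ _) (-‿cong (x[y-z]≈xy-xz _ _ _)) ⟨
      a ·1 * ⟦ c , d ⟧ - b ·1 * ⟦ c , d ⟧
        ≈⟨ [y-z]x≈yx-zx _ _ _ ⟨
      ⟦ a , b ⟧ * ⟦ c , d ⟧ ∎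

    homomorphism : difference -Raw-AlmostCommutative⟶ fromCommutativeRing R
    homomorphism = record
      { ⟦_⟧    = ⟦_⟧
      ; +-homo = λ (a , b) (c , d) → +-homo a b c d
      ; *-homo = λ (a , b) (c , d) → *-homo a b c d
      ; -‿homo = λ (a , b) → sym (⁻¹-anti-homo‿- (a ·1) (b ·1))
      ; 0-homo = -‿inverseʳ 0#
      ; 1-homo = trans (+-cong (+-identityʳ 1#) ε⁻¹≈ε) (+-identityʳ 1#)
      }

    ⟦⟧-≟ : ∀ p q → Maybe (⟦ p ⟧ ≈ ⟦ q ⟧)
    ⟦⟧-≟ p q = map (λ { ≡.refl → refl }) (dec⇒maybe (≡-dec ℕ._≟_ ℕ._≟_ p q))

  open RingSolver difference (fromCommutativeRing R) homomorphism ⟦⟧-≟ public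
    using (solve; _:=_; _:+_; _:-_; _:*_; :-_)

-- Order and sign rules in an ordered field, without trichotomy.

module OrderedFieldProperties {c ℓ₁ ℓ₂} (F : OrderedField c ℓ₁ ℓ₂) where
  open OrderedField F
  open IsStrictPartialOrder isStrictPartialOrder using (<-resp-≈) renaming (asym to <-asym)
  open CommutativeRing commutativeRing using (semiring)
  open SemiringMult semiring using (×-homo-+; ×1-homo-*)
  open IntegerCoefficientSolver commutativeRing

  -- Cotransitivity of apartness leaves four cases; in the two where `z` lies below `x` or above
  -- `y`, transitivity with `x<y` settles the matter.
  <-cotrans : ∀ {x y} → x < y → ∀ z → x < z ⊎ z < y
  <-cotrans x<y z with #-cotrans (inj₁ x<y) z
  ... | inj₁ (inj₁ x<z) = inj₁ x<z
  ... | inj₁ (inj₂ z<x) = inj₂ (<-trans z<x x<y)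
  ... | inj₂ (inj₁ z<y) = inj₂ z<y
  ... | inj₂ (inj₂ y<z) = inj₁ (<-trans x<y y<z)

  <⇒≤ : ∀ {x y} → x < y → x ≤ y
  <⇒≤ = <-asym

  ≤-reflexive : ∀ {x y} → x ≈ y → x ≤ y
  ≤-reflexive = <-irrefl ∘ sym

  -- As `_≤_` is a negated `_<_`, a strict conclusion has to come from cotransitivity: locating `x`
  -- relative to `y < z` leaves `y < x`, which is refuted, or the goal.
  ≤-<-trans : ∀ {x y z} → x ≤ y → y < z → x < z
  ≤-<-trans {x} x≤y y<z = [ ⊥-elim ∘ x≤y , id ]′ (<-cotrans y<z x)

  <-≤-trans : ∀ {x y z} → x < y → y ≤ z → x < z
  <-≤-trans {z = z} x<y y≤z = [ id , ⊥-elim ∘ y≤z ]′ (<-cotrans x<y z)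

  ≤-trans : ∀ {x y z} → x ≤ y → y ≤ z → x ≤ z
  ≤-trans x≤y y≤z z<x = y≤z (<-≤-trans z<x x≤y)

  ≤-isPreorder : IsPreorder _≈_ _≤_
  ≤-isPreorder = record
    { isEquivalence = isEquivalence
    ; reflexive     = ≤-reflexive
    ; trans         = ≤-trans
    }

  module ≤-Reasoning = TripleReasoning
    ≤-isPreorder <-asym <-trans <-resp-≈ <⇒≤ <-≤-trans ≤-<-trans
  open ≤-Reasoning

  x<y⇒0<y-x : ∀ {x y} → x < y → 0# < y - x
  x<y⇒0<y-x {x} x<y = <-respˡ-≈ (-‿inverseʳ x) (+-monoˡ-< (- x) x<y)

  0<y-x⇒x<y : ∀ {x y} → 0# < y - x → x < y
  0<y-x⇒x<y {x} {y} 0<y-x = <-respˡ-≈ (+-identityˡ x) (<-respʳ-≈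
    (solve 2 (λ x y → y :- x :+ x := y) refl x y) (+-monoˡ-< x 0<y-x))

  +-monoˡ-≤ : ∀ z {x y} → x ≤ y → x + z ≤ y + z
  +-monoˡ-≤ z {x} {y} x≤y y+z<x+z = x≤y (0<y-x⇒x<y (<-respʳ-≈
    (solve 3 (λ x y z → (x :+ z) :- (y :+ z) := x :- y) refl x y z)
    (x<y⇒0<y-x y+z<x+z)))

  +-monoʳ-≤ : ∀ z {x y} → x ≤ y → z + x ≤ z + y
  +-monoʳ-≤ z {x} {y} x≤y = begin
    z + x ≈⟨ +-comm z x ⟩
    x + z ≤⟨ +-monoˡ-≤ z x≤y ⟩
    y + z ≈⟨ +-comm y z ⟩
    z + y ∎

  +-mono-≤ : ∀ {x y z w} → x ≤ y → z ≤ w → x + z ≤ y + w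
  +-mono-≤ x≤y z≤w = ≤-trans (+-monoˡ-≤ _ x≤y) (+-monoʳ-≤ _ z≤w)

  0≤y-x⇒x≤y : ∀ {x y} → 0# ≤ y - x → x ≤ y
  0≤y-x⇒x≤y {x} {y} 0≤y-x = begin
    x          ≈⟨ +-identityˡ x ⟨
    0# + x     ≤⟨ +-monoˡ-≤ x 0≤y-x ⟩
    y - x + x  ≈⟨ solve 2 (λ x y → y :- x :+ x := y) refl x y ⟩
    y          ∎

  x≤y⇒0≤y-x : ∀ {x y} → x ≤ y → 0# ≤ y - x
  x≤y⇒0≤y-x {x} {y} x≤y = begin
    0#     ≈⟨ -‿inverseʳ x ⟨
    x - x  ≤⟨ +-monoˡ-≤ (- x) x≤y ⟩
    y - x  ∎

  -‿anti-mono-≤ : ∀ {x y} → x ≤ y → - y ≤ - x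
  -‿anti-mono-≤ {x} {y} x≤y = 0≤y-x⇒x≤y (≤-trans (x≤y⇒0≤y-x x≤y)
    (≤-reflexive (solve 2 (λ x y → y :- x := :- x :- :- y) refl x y)))

  x<0⇒0<-x : ∀ {x} → x < 0# → 0# < - x
  x<0⇒0<-x {x} x<0 = <-respʳ-≈ (+-identityˡ (- x)) (x<y⇒0<y-x x<0)

  -- Being apart from zero is the same as being invertible, and if `i` inverts `x * y` then `i * x`
  -- inverts `y`. This is what allows a case split on the sign of a factor.
  x*y#0⇒y#0 : ∀ {x y} → x * y # 0# → y # 0#
  x*y#0⇒y#0 {x} {y} xy#0 = invertible⇒#
    (i * x , trans (shift i x y) (proj₁ (proj₂ inv))
           , trans (*-comm (y - 0#) (i * x)) (trans (shift i x y) (proj₁ (proj₂ inv))))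
    where
    inv = #⇒invertible xy#0
    i = proj₁ inv
    shift : ∀ i x y → i * x * (y - 0#) ≈ i * (x * y - 0#)
    shift i x y = trans (*-congˡ (x-0≈x y)) (trans (*-assoc i x y) (*-congˡ (sym (x-0≈x _))))

  *-cancelˡ-pos : ∀ {x y} → 0# < x → 0# < x * y → 0# < y
  *-cancelˡ-pos {x} {y} 0<x 0<xy with x*y#0⇒y#0 (inj₂ 0<xy)
  ... | inj₂ 0<y = 0<y
  ... | inj₁ y<0 = ⊥-elim (<-asym 0<xy (0<y-x⇒x<y (<-respʳ-≈
    -- Zero is entered as `z :- z` with `z` instantiated to `0#`, the solver syntax in scope having
    -- no constants.
    (trans (solve 3 (λ z x y → x :* (:- y) := (z :- z) :- x :* y) refl 0# x y) (+-congʳ (-‿inverseʳ 0#)))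
    (*-pos 0<x (x<0⇒0<-x y<0)))))

  *-monoʳ-<-pos : ∀ {x y z} → 0# < z → x < y → z * x < z * y
  *-monoʳ-<-pos {x} {y} {z} 0<z x<y = 0<y-x⇒x<y (<-respʳ-≈
    (solve 3 (λ x y z → z :* (y :- x) := z :* y :- z :* x) refl x y z)
    (*-pos 0<z (x<y⇒0<y-x x<y)))

  *-cancelˡ-<-pos : ∀ {x y z} → 0# < z → z * x < z * y → x < y
  *-cancelˡ-<-pos {x} {y} {z} 0<z zx<zy = 0<y-x⇒x<y (*-cancelˡ-pos 0<z (<-respʳ-≈
    (solve 3 (λ x y z → z :* y :- z :* x := z :* (y :- x)) refl x y z)
    (x<y⇒0<y-x zx<zy)))

  *-cancelˡ-≤-pos : ∀ {x y z} → 0# < z → z * x ≤ z * y → x ≤ y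
  *-cancelˡ-≤-pos 0<z zx≤zy y<x = zx≤zy (*-monoʳ-<-pos 0<z y<x)

  -- The goal is a negation, so `x * y < 0#` may be assumed; it makes both factors apart from zero,
  -- and every combination of signs is then contradictory.
  *-nonneg : ∀ {x y} → 0# ≤ x → 0# ≤ y → 0# ≤ x * y
  *-nonneg {x} {y} 0≤x 0≤y xy<0
    with x*y#0⇒y#0 (inj₁ xy<0) | x*y#0⇒y#0 (inj₁ (<-respˡ-≈ (*-comm x y) xy<0))
  ... | inj₁ y<0 | _        = 0≤y y<0
  ... | inj₂ _   | inj₁ x<0 = 0≤x x<0
  ... | inj₂ 0<y | inj₂ 0<x = <-asym xy<0 (*-pos 0<x 0<y)

  *-monoʳ-≤-nonneg : ∀ {x y z} → 0# ≤ z → x ≤ y → z * x ≤ z * y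
  *-monoʳ-≤-nonneg {x} {y} {z} 0≤z x≤y = 0≤y-x⇒x≤y (begin
    0#             ≤⟨ *-nonneg 0≤z (x≤y⇒0≤y-x x≤y) ⟩
    z * (y - x)    ≈⟨ solve 3 (λ x y z → z :* (y :- x) := z :* y :- z :* x) refl x y z ⟩
    z * y - z * x  ∎)

  -- Factor `y² - x²` as `(x + y)(y - x)` and cancel the positive first factor.
  x²<y²⇒x<y : ∀ {x y} → 0# ≤ x → 0# < y → x * x < y * y → x < y
  x²<y²⇒x<y {x} {y} 0≤x 0<y x²<y² = 0<y-x⇒x<y (*-cancelˡ-pos 0<x+y (<-respʳ-≈
    (solve 2 (λ x y → y :* y :- x :* x := (x :+ y) :* (y :- x)) refl x y)
    (x<y⇒0<y-x x²<y²)))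
    where
    0<x+y : 0# < x + y
    0<x+y = begin-strict
      0#      <⟨ 0<y ⟩
      y       ≈⟨ +-identityˡ y ⟨
      0# + y  ≤⟨ +-monoˡ-≤ y 0≤x ⟩
      x + y   ∎

  *-mono-square-≤ : ∀ {x y} → 0# ≤ x → x ≤ y → x * x ≤ y * y
  *-mono-square-≤ {x} {y} 0≤x x≤y = begin
    x * x ≤⟨ *-monoʳ-≤-nonneg 0≤x x≤y ⟩
    x * y ≈⟨ *-comm x y ⟩
    y * x ≤⟨ *-monoʳ-≤-nonneg (≤-trans 0≤x x≤y) x≤y ⟩
    y * y ∎

  x²≤y²⇒x≤y : ∀ {x y} → 0# ≤ y → x * x ≤ y * y → x ≤ y
  x²≤y²⇒x≤y {x} {y} 0≤y x²≤y² y<x = x²≤y² (begin-strict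
    y * y ≤⟨ *-monoʳ-≤-nonneg 0≤y (<⇒≤ y<x) ⟩
    y * x ≈⟨ *-comm y x ⟩
    x * y <⟨ *-monoʳ-<-pos (≤-<-trans 0≤y y<x) y<x ⟩
    x * x ∎)

  -- Natural numbers and their reciprocals in the field.

  fromℕ-+ : ∀ m n → fromℕ (m ℕ.+ n) ≈ fromℕ m + fromℕ n
  fromℕ-+ = ×-homo-+ 1#

  fromℕ-* : ∀ m n → fromℕ (m ℕ.* n) ≈ fromℕ m * fromℕ n
  fromℕ-* = ×1-homo-*

  fromℕ-nonneg : ∀ n → 0# ≤ fromℕ n
  fromℕ-nonneg zero    = ≤-reflexive refl
  fromℕ-nonneg (suc n) = <⇒≤ (0<fromℕ-suc n)

  fromℕ-mono-< : ∀ {m n} → m ℕ.< n → fromℕ m < fromℕ n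
  fromℕ-mono-< {m} {n} m<n with ℕ.m≤n⇒∃[o]m+o≡n m<n
  ... | o , ≡.refl = begin-strict
    fromℕ m                 ≈⟨ +-identityˡ _ ⟨
    0# + fromℕ m            <⟨ +-monoˡ-< _ (0<fromℕ-suc o) ⟩
    fromℕ (suc o) + fromℕ m ≈⟨ fromℕ-+ (suc o) m ⟨
    fromℕ (suc o ℕ.+ m)     ≡⟨ ≡.cong (λ i → fromℕ (suc i)) (ℕ.+-comm o m) ⟩
    fromℕ (suc m ℕ.+ o)     ∎

  fromℕ-suc*1/suc : ∀ n → fromℕ (suc n) * 1/suc n ≈ 1#
  fromℕ-suc*1/suc n = proj₂ (proj₂ (fromℕ-suc-invertible n))

  0<1/suc : ∀ n → 0# < 1/suc n
  0<1/suc n = *-cancelˡ-pos (0<fromℕ-suc n) (<-respʳ-≈ (sym (fromℕ-suc*1/suc n)) 0<1)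

  1/suc≤1 : ∀ n → 1/suc n ≤ 1#
  1/suc≤1 n = *-cancelˡ-≤-pos (0<fromℕ-suc n) (begin
    fromℕ (suc n) * 1/suc n ≈⟨ fromℕ-suc*1/suc n ⟩
    1#                      ≈⟨ +-identityʳ 1# ⟨
    1# + 0#                 ≤⟨ +-monoʳ-≤ 1# (fromℕ-nonneg n) ⟩
    fromℕ (suc n)           ≈⟨ *-identityʳ _ ⟨
    fromℕ (suc n) * 1#      ∎)

  1/suc-square : ∀ k → fromℕ (suc k ℕ.* suc k) * (1/suc k * 1/suc k) ≈ 1#
  1/suc-square k = begin-equality
    fromℕ (suc k ℕ.* suc k) * (ε * ε) ≈⟨ *-congʳ (fromℕ-* (suc k) (suc k)) ⟩
    (s * s) * (ε * ε)
      ≈⟨ solve 2 (λ s ε → (s :* s) :* (ε :* ε) := (s :* ε) :* (s :* ε)) refl s ε ⟩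
    (s * ε) * (s * ε)                 ≈⟨ *-cong (fromℕ-suc*1/suc k) (fromℕ-suc*1/suc k) ⟩
    1# * 1#                           ≈⟨ *-identityʳ 1# ⟩
    1#                                ∎
    where
    s = fromℕ (suc k)
    ε = 1/suc k

  -- After multiplication by `K + 1` the left side is 1 and the right side is `1 + ε²`. The strict
  -- gap supplies the two thresholds that `small-increment` compares against.
  1/suc[suck²]<[1/suck]² : ∀ k → 1/suc (suc k ℕ.* suc k) < 1/suc k * 1/suc k
  1/suc[suck²]<[1/suck]² k = *-cancelˡ-<-pos (0<fromℕ-suc K) (begin-strict
    fromℕ (suc K) * 1/suc K               ≈⟨ fromℕ-suc*1/suc K ⟩
    1#                                    ≈⟨ +-identityˡ 1# ⟨
    0# + 1#                               <⟨ +-monoˡ-< 1# (*-pos (0<1/suc k) (0<1/suc k)) ⟩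
    ε² + 1#                               ≈⟨ +-cong (*-identityˡ ε²) (1/suc-square k) ⟨
    1# * ε² + fromℕ K * ε²                ≈⟨ distribʳ ε² 1# (fromℕ K) ⟨
    fromℕ (suc K) * ε²                    ∎)
    where
    K = suc k ℕ.* suc k
    ε² = 1/suc k * 1/suc k

  -- Pigeonhole for the increments of a sequence.

  subtract-increment : ∀ {δ x y} n → δ < y - x → y < fromℕ (suc n) * δ → x < fromℕ n * δ
  subtract-increment {δ} {x} {y} n δ<y-x y<[n+1]δ = 0<y-x⇒x<y (begin-strict
    0#                                     ≈⟨ -‿inverseʳ y ⟨
    y - y                                  <⟨ +-monoˡ-< (- y) y<[n+1]δ ⟩
    (1# + fromℕ n) * δ - y                 ≈⟨ +-congʳ (distribʳ δ 1# (fromℕ n)) ⟩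
    1# * δ + fromℕ n * δ - y               ≈⟨ +-congʳ (+-congʳ (*-identityˡ δ)) ⟩
    δ + fromℕ n * δ - y                    ≈⟨ +-assoc δ (fromℕ n * δ) (- y) ⟩
    δ + (fromℕ n * δ - y)                  <⟨ +-monoˡ-< (fromℕ n * δ - y) δ<y-x ⟩
    (y - x) + (fromℕ n * δ - y)
      ≈⟨ solve 3 (λ x y z → (y :- x) :+ (z :- y) := z :- x) refl x y (fromℕ n * δ) ⟩
    fromℕ n * δ - x                        ∎)

  -- If all `R` increments exceeded `δ`, then `s R` would be at least `R δ`. The search runs
  -- downwards from the last increment; having two thresholds `δ < ε` lets cotransitivity decide
  -- each step, since a single real threshold could not be tested.
  small-increment : ∀ {δ ε} → δ < ε → (s : ℕ → Carrier) → 0# ≤ s 0 →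
    ∀ R → s R < fromℕ R * δ → ∃[ i ] (i ℕ.< R × s (suc i) - s i < ε)
  small-increment {δ} δ<ε s 0≤s₀ zero s₀<0δ =
    ⊥-elim (0≤s₀ (<-respʳ-≈ (zeroˡ δ) s₀<0δ))
  small-increment δ<ε s 0≤s₀ (suc R) s<[R+1]δ with <-cotrans δ<ε (s (suc R) - s R)
  ... | inj₂ small = R , ℕ.≤-refl , small
  ... | inj₁ δ<d
    with i , i<R , small ← small-increment δ<ε s 0≤s₀ R (subtract-increment R δ<d s<[R+1]δ)
    = i , ℕ.m≤n⇒m≤1+n i<R , small

-- Inner products and norms.

module HilbertSpaceProperties {c ℓ₁ ℓ₂ m ℓm} {ℝ : RealNumbers c ℓ₁ ℓ₂} (X : HilbertSpace ℝ m ℓm) where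
  open RealNumbers ℝ using (orderedField)
  open OrderedField orderedField
  open OrderedFieldProperties orderedField
  open IntegerCoefficientSolver commutativeRing
  open HilbertSpace X
  open AbelianGroupProperties (CommutativeRing.+-abelianGroup commutativeRing) using (inverseʳ-unique)
  open ≤-Reasoning

  ⟨⟩-+ʳ : ∀ x y z → ⟨ x , y +ᴹ z ⟩ ≈ ⟨ x , y ⟩ + ⟨ x , z ⟩
  ⟨⟩-+ʳ x y z = trans (⟨⟩-comm x _) (trans (⟨⟩-+ˡ y z x) (+-cong (⟨⟩-comm y x) (⟨⟩-comm z x)))

  ⟨⟩-*ʳ : ∀ a x y → ⟨ x , a *ₗ y ⟩ ≈ a * ⟨ x , y ⟩
  ⟨⟩-*ʳ a x y = trans (⟨⟩-comm x _) (trans (⟨⟩-*ˡ a y x) (*-congˡ (⟨⟩-comm y x)))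

  ⟨⟩-0ˡ : ∀ x → ⟨ 0ᴹ , x ⟩ ≈ 0#
  ⟨⟩-0ˡ x = begin-equality
    ⟨ 0ᴹ , x ⟩          ≈⟨ ⟨⟩-cong (*ₗ-zeroˡ 0ᴹ) ≈ᴹ-refl ⟨
    ⟨ 0# *ₗ 0ᴹ , x ⟩    ≈⟨ ⟨⟩-*ˡ 0# 0ᴹ x ⟩
    0# * ⟨ 0ᴹ , x ⟩     ≈⟨ zeroˡ _ ⟩
    0#                  ∎

  ⟨⟩-ᴹˡ : ∀ x y z → ⟨ x -ᴹ y , z ⟩ ≈ ⟨ x , z ⟩ - ⟨ y , z ⟩
  ⟨⟩-ᴹˡ x y z =
    trans (⟨⟩-+ˡ x (-ᴹ y) z) (+-congˡ (inverseʳ-unique ⟨ y , z ⟩ ⟨ -ᴹ y , z ⟩ (begin-equality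
    ⟨ y , z ⟩ + ⟨ -ᴹ y , z ⟩  ≈⟨ ⟨⟩-+ˡ y (-ᴹ y) z ⟨
    ⟨ y -ᴹ y , z ⟩            ≈⟨ ⟨⟩-cong (-ᴹ‿inverseʳ y) ≈ᴹ-refl ⟩
    ⟨ 0ᴹ , z ⟩                ≈⟨ ⟨⟩-0ˡ z ⟩
    0#                        ∎)))

  ⟨⟩-ᴹʳ : ∀ x y z → ⟨ x , y -ᴹ z ⟩ ≈ ⟨ x , y ⟩ - ⟨ x , z ⟩
  ⟨⟩-ᴹʳ x y z =
    trans (⟨⟩-comm x _) (trans (⟨⟩-ᴹˡ y z x) (+-cong (⟨⟩-comm y x) (-‿cong (⟨⟩-comm z x))))

  ⟨⟩-bi-ᴹ : ∀ x y z w → ⟨ x -ᴹ y , z -ᴹ w ⟩ ≈ (⟨ x , z ⟩ - ⟨ x , w ⟩) - (⟨ y , z ⟩ - ⟨ y , w ⟩)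
  ⟨⟩-bi-ᴹ x y z w = trans (⟨⟩-ᴹˡ x y (z -ᴹ w)) (+-cong (⟨⟩-ᴹʳ x z w) (-‿cong (⟨⟩-ᴹʳ y z w)))

  infix 9 _²
  _² : Carrierᴹ → Carrier
  x ² = ⟨ x , x ⟩

  ²-cong : ∀ {x y} → x ≈ᴹ y → x ² ≈ y ²
  ²-cong x≈y = ⟨⟩-cong x≈y x≈y

  ²-ᴹ : ∀ x y → (x -ᴹ y) ² ≈ x ² + y ² - (⟨ x , y ⟩ + ⟨ x , y ⟩)
  ²-ᴹ x y = begin-equality
    (x -ᴹ y) ²                                        ≈⟨ ⟨⟩-bi-ᴹ x y x y ⟩
    (x ² - ⟨ x , y ⟩) - (⟨ y , x ⟩ - y ²)             ≈⟨ +-congˡ (-‿cong (+-congʳ (⟨⟩-comm y x))) ⟩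
    (x ² - ⟨ x , y ⟩) - (⟨ x , y ⟩ - y ²)
      ≈⟨ solve 3 (λ A B T → (A :- T) :- (T :- B) := A :+ B :- (T :+ T)) refl (x ²) (y ²) ⟨ x , y ⟩ ⟩
    x ² + y ² - (⟨ x , y ⟩ + ⟨ x , y ⟩)               ∎

  ²-swap : ∀ x y → (x -ᴹ y) ² ≈ (y -ᴹ x) ²
  ²-swap x y = begin-equality
    (x -ᴹ y) ²                           ≈⟨ ²-ᴹ x y ⟩
    x ² + y ² - (⟨ x , y ⟩ + ⟨ x , y ⟩)
      ≈⟨ +-cong (+-comm _ _) (-‿cong (+-cong (⟨⟩-comm x y) (⟨⟩-comm x y))) ⟩
    y ² + x ² - (⟨ y , x ⟩ + ⟨ y , x ⟩)  ≈⟨ ²-ᴹ y x ⟨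
    (y -ᴹ x) ²                           ∎

  x≈0⇒x²≈0 : ∀ {x} → x ≈ᴹ 0ᴹ → x ² ≈ 0#
  x≈0⇒x²≈0 {x} x≈0 = trans (⟨⟩-cong x≈0 ≈ᴹ-refl) (⟨⟩-0ˡ x)

  ²-*ₗ : ∀ a x → (a *ₗ x) ² ≈ a * a * x ²
  ²-*ₗ a x = trans (⟨⟩-*ˡ a x _) (trans (*-congˡ (⟨⟩-*ʳ a x x)) (sym (*-assoc a a _)))

  -- Compatibility of the norm with `_≈ᴹ_` is not an axiom; it follows because a nonnegative number
  -- is determined by its square.
  ∥∥-cong : ∀ {x y} → x ≈ᴹ y → ∥ x ∥ ≤ ∥ y ∥
  ∥∥-cong {x} {y} x≈y = x²≤y²⇒x≤y (∥∥-nonneg y) (≤-reflexive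
    (trans (∥∥-square x) (trans (²-cong x≈y) (sym (∥∥-square y)))))

  ∥∥-≤⇒²-≤ : ∀ {x y} → ∥ x ∥ ≤ ∥ y ∥ → x ² ≤ y ²
  ∥∥-≤⇒²-≤ {x} {y} x≤y = begin
    x ²           ≈⟨ ∥∥-square x ⟨
    ∥ x ∥ * ∥ x ∥ ≤⟨ *-mono-square-≤ (∥∥-nonneg x) x≤y ⟩
    ∥ y ∥ * ∥ y ∥ ≈⟨ ∥∥-square y ⟩
    y ²           ∎

  -- Both sides have the same square, and nonnegativity of the right side allows the roots to be
  -- compared.
  scaled-∥∥-≤ : ∀ {a b x y} → 0# ≤ b → a *ₗ x ≈ᴹ b *ₗ y → a * ∥ x ∥ ≤ b * ∥ y ∥
  scaled-∥∥-≤ {a} {b} {x} {y} 0≤b ax≈by =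
    x²≤y²⇒x≤y (*-nonneg 0≤b (∥∥-nonneg y)) (≤-reflexive (begin-equality
    (a * ∥ x ∥) * (a * ∥ x ∥)  ≈⟨ square a x ⟩
    (a *ₗ x) ²                 ≈⟨ ²-cong ax≈by ⟩
    (b *ₗ y) ²                 ≈⟨ square b y ⟨
    (b * ∥ y ∥) * (b * ∥ y ∥)  ∎))
    where
    square : ∀ a x → (a * ∥ x ∥) * (a * ∥ x ∥) ≈ (a *ₗ x) ²
    square a x = begin-equality
      (a * ∥ x ∥) * (a * ∥ x ∥)
        ≈⟨ solve 2 (λ a n → (a :* n) :* (a :* n) := a :* a :* (n :* n)) refl a ∥ x ∥ ⟩
      a * a * (∥ x ∥ * ∥ x ∥)    ≈⟨ *-congˡ (∥∥-square x) ⟩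
      a * a * x ²                ≈⟨ ²-*ₗ a x ⟨
      (a *ₗ x) ²                 ∎

  -- The key identity: β (y² - ⟨y, y′⟩) - α (⟨y, y′⟩ - y′²) equals both
  -- αβ ⟨y - y′, z - z′⟩ and (β - α)(y² - ⟨y, y′⟩) + α (y - y′)², so that
  -- y² ≤ ⟨y, y′⟩ and (y - y′)² = y² + y′² - 2⟨y, y′⟩ ≤ y′² - y².
  path-increment : ∀ {α β y z y′ z′} → 0# ≤ α → α < β → y ≈ᴹ α *ₗ z → y′ ≈ᴹ β *ₗ z′ →
    ⟨ y -ᴹ y′ , z -ᴹ z′ ⟩ ≤ 0# → (y -ᴹ y′) ² ≤ y′ ² - y ²
  path-increment {α} {β} {y} {z} {y′} {z′} 0≤α α<β y≈αz y′≈βz′ ⟨⟩≤0 = begin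
    (y -ᴹ y′) ²     ≈⟨ ²-ᴹ y y′ ⟩
    A + B - (T + T)
      ≈⟨ solve 3 (λ A B T → A :+ B :- (T :+ T) := (B :- A) :+ ((A :- T) :+ (A :- T))) refl A B T ⟩
    (B - A) + ((A - T) + (A - T)) ≤⟨ +-monoʳ-≤ (B - A) (+-mono-≤ A-T≤0 A-T≤0) ⟩
    (B - A) + (0# + 0#) ≈⟨ trans (+-congˡ (+-identityʳ 0#)) (+-identityʳ _) ⟩
    B - A ∎
    where
    A = y ²
    B = y′ ²
    T = ⟨ y , y′ ⟩
    pairing : α * β * ⟨ y -ᴹ y′ , z -ᴹ z′ ⟩ ≈ β * (A - T) - α * (T - B)
    pairing = begin-equality
      α * β * ⟨ y -ᴹ y′ , z -ᴹ z′ ⟩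
        ≈⟨ *-congˡ (⟨⟩-bi-ᴹ y y′ z z′) ⟩
      α * β * ((⟨ y , z ⟩ - ⟨ y , z′ ⟩) - (⟨ y′ , z ⟩ - ⟨ y′ , z′ ⟩))
        ≈⟨ solve 6 (λ α β p q r s → α :* β :* ((p :- q) :- (r :- s)) :=
             β :* (α :* p :- α :* r) :- α :* (β :* q :- β :* s)) refl α β ⟨ y , z ⟩ ⟨ y , z′ ⟩ ⟨ y′ , z ⟩ ⟨ y′ , z′ ⟩ ⟩
      β * (α * ⟨ y , z ⟩ - α * ⟨ y′ , z ⟩) - α * (β * ⟨ y , z′ ⟩ - β * ⟨ y′ , z′ ⟩)
        ≈⟨ +-cong (*-congˡ (+-cong (scale y≈αz y) (-‿cong (trans (scale y≈αz y′) (⟨⟩-comm y′ y)))))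
                  (-‿cong (*-congˡ (+-cong (scale y′≈βz′ y) (-‿cong (scale y′≈βz′ y′))))) ⟩
      β * (A - T) - α * (T - B) ∎
      where
      scale : ∀ {a v w} → v ≈ᴹ a *ₗ w → ∀ x → a * ⟨ x , w ⟩ ≈ ⟨ x , v ⟩
      scale {a} {v} {w} v≈aw x = trans (sym (⟨⟩-*ʳ a x w)) (⟨⟩-cong ≈ᴹ-refl (≈ᴹ-sym v≈aw))

    A-T≤0 : A - T ≤ 0#
    A-T≤0 = *-cancelˡ-≤-pos (x<y⇒0<y-x α<β) (begin
      (β - α) * (A - T)
        ≈⟨ +-identityʳ _ ⟨
      (β - α) * (A - T) + 0#
        ≤⟨ +-monoʳ-≤ _ (*-nonneg 0≤α (⟨⟩-nonneg (y -ᴹ y′))) ⟩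
      (β - α) * (A - T) + α * (y -ᴹ y′) ²
        ≈⟨ +-congˡ (*-congˡ (²-ᴹ y y′)) ⟩
      (β - α) * (A - T) + α * (A + B - (T + T))
        ≈⟨ solve 5 (λ α β A B T → (β :- α) :* (A :- T) :+ α :* (A :+ B :- (T :+ T)) := β :* (A :- T) :- α :* (T :- B)) refl α β A B T ⟩
      β * (A - T) - α * (T - B)
        ≈⟨ pairing ⟨
      α * β * ⟨ y -ᴹ y′ , z -ᴹ z′ ⟩
        ≤⟨ *-monoʳ-≤-nonneg (*-nonneg 0≤α (<⇒≤ (≤-<-trans 0≤α α<β))) ⟨⟩≤0 ⟩
      α * β * 0#
        ≈⟨ trans (zeroʳ _) (sym (zeroʳ (β - α))) ⟩
      (β - α) * 0# ∎)

  -- Expanding around `x` gives y² = x² + 2S + (y - x)², where S is the inner product in question; a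
  -- positive S would force y² above x².
  ⟨x,y-x⟩≤0 : ∀ {x y} → ∥ y ∥ ≤ ∥ x ∥ → ⟨ x , y -ᴹ x ⟩ ≤ 0#
  ⟨x,y-x⟩≤0 {x} {y} y≤x = λ 0<S → ∥∥-≤⇒²-≤ y≤x (begin-strict
    x ²                            ≈⟨ +-identityʳ _ ⟨
    x ² + 0#                       ≤⟨ +-monoʳ-≤ (x ²) (⟨⟩-nonneg (y -ᴹ x)) ⟩
    x ² + (y -ᴹ x) ²               ≈⟨ +-identityˡ _ ⟨
    0# + (x ² + (y -ᴹ x) ²)        <⟨ +-monoˡ-< _ 0<S ⟩
    S + (x ² + (y -ᴹ x) ²)         ≈⟨ +-congʳ (+-identityˡ S) ⟨
    0# + S + (x ² + (y -ᴹ x) ²)    <⟨ +-monoˡ-< _ (+-monoˡ-< S 0<S) ⟩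
    S + S + (x ² + (y -ᴹ x) ²)
      ≈⟨ +-cong (+-cong S≈ S≈) (+-congˡ (trans (²-swap y x) (²-ᴹ x y))) ⟩
    (T - A) + (T - A) + (A + (A + B - (T + T)))
                                   ≈⟨ solve 3 (λ A B T → (T :- A) :+ (T :- A) :+ (A :+ (A :+ B :- (T :+ T))) := B) refl A B T ⟩
    y ²                            ∎)
    where
    A = x ²
    B = y ²
    T = ⟨ x , y ⟩
    S = ⟨ x , y -ᴹ x ⟩
    S≈ : S ≈ T - A
    S≈ = ⟨⟩-ᴹʳ x y x

-- Fixed points of the contractions.

module NonexpansivePath {c ℓ₁ ℓ₂ m ℓm} {ℝ : RealNumbers c ℓ₁ ℓ₂} (X : HilbertSpace ℝ m ℓm)
  (U : HilbertSpace.Carrierᴹ X → HilbertSpace.Carrierᴹ X) (U-nonexpansive : Nonexpansive X U)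
  (v₀ : HilbertSpace.Carrierᴹ X)
  where
  open HilbertSpace X
  open RealNumbers ℝ using (orderedField; archimedean)
  open OrderedField orderedField
  open OrderedFieldProperties orderedField
  open HilbertSpaceProperties X
  open AbelianGroupLemmas +ᴹ-abelianGroup
  open IntegerCoefficientSolver commutativeRing
  open ≤-Reasoning

  private
    T : ℕ → Carrierᴹ → Carrierᴹ
    T = contraction X U v₀

    module ≈ᴹ-Reasoning = SetoidReasoning ≈ᴹ-setoid

  *ₗ-distrib-ᴹ : ∀ a x y → a *ₗ (x -ᴹ y) ≈ᴹ a *ₗ x -ᴹ a *ₗ y
  *ₗ-distrib-ᴹ a x y = ≈ᴹ-trans (*ₗ-distribˡ a x (-ᴹ y)) (+ᴹ-congˡ (uniqueʳ‿-ᴹ _ _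
    (≈ᴹ-trans (≈ᴹ-sym (*ₗ-distribˡ a y (-ᴹ y))) (≈ᴹ-trans (*ₗ-congˡ (-ᴹ‿inverseʳ y)) (*ₗ-zeroʳ a)))))

  -- Clears the denominator in the contraction, so that later arguments work with natural-number
  -- coefficients only.
  [1+n]T≈nU+v₀ : ∀ n x → fromℕ (suc n) *ₗ T n x ≈ᴹ fromℕ n *ₗ U x +ᴹ v₀
  [1+n]T≈nU+v₀ n x = E.begin
    N *ₗ ((1# - r) *ₗ U x +ᴹ r *ₗ v₀)           E.≈⟨ *ₗ-distribˡ N _ _ ⟩
    N *ₗ ((1# - r) *ₗ U x) +ᴹ N *ₗ (r *ₗ v₀)    E.≈⟨ +ᴹ-cong (*ₗ-assoc N _ _) (*ₗ-assoc N _ _) ⟨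
    (N * (1# - r)) *ₗ U x +ᴹ (N * r) *ₗ v₀      E.≈⟨ +ᴹ-cong (*ₗ-congʳ N[1-r]≈n) (*ₗ-congʳ (fromℕ-suc*1/suc n)) ⟩
    fromℕ n *ₗ U x +ᴹ 1# *ₗ v₀                  E.≈⟨ +ᴹ-congˡ (*ₗ-identityˡ v₀) ⟩
    fromℕ n *ₗ U x +ᴹ v₀                        E.∎
    where
    module E = ≈ᴹ-Reasoning
    N = fromℕ (suc n)
    r = 1/suc n
    N[1-r]≈n : N * (1# - r) ≈ fromℕ n
    N[1-r]≈n = begin-equality
      N * (1# - r)           ≈⟨ solve 3 (λ N e r → N :* (e :- r) := N :* e :- N :* r) refl N 1# r ⟩
      N * 1# - N * r         ≈⟨ +-cong (*-identityʳ N) (-‿cong (fromℕ-suc*1/suc n)) ⟩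
      1# + fromℕ n - 1#      ≈⟨ solve 2 (λ e n → e :+ n :- e := n) refl 1# (fromℕ n) ⟩
      fromℕ n                ∎

  contraction-step : ∀ n x y → fromℕ (suc n) *ₗ (T n x -ᴹ T n y) ≈ᴹ fromℕ n *ₗ (U x -ᴹ U y)
  contraction-step n x y = E.begin
    N *ₗ (T n x -ᴹ T n y)                           E.≈⟨ *ₗ-distrib-ᴹ N _ _ ⟩
    N *ₗ T n x -ᴹ N *ₗ T n y                        E.≈⟨ +ᴹ-cong ([1+n]T≈nU+v₀ n x) (-ᴹ‿cong ([1+n]T≈nU+v₀ n y)) ⟩
    (fromℕ n *ₗ U x +ᴹ v₀) -ᴹ (fromℕ n *ₗ U y +ᴹ v₀) E.≈⟨ [x+z]-[y+z]≈x-y _ _ v₀ ⟩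
    fromℕ n *ₗ U x -ᴹ fromℕ n *ₗ U y                E.≈⟨ *ₗ-distrib-ᴹ (fromℕ n) _ _ ⟨
    fromℕ n *ₗ (U x -ᴹ U y)                         E.∎
    where
    module E = ≈ᴹ-Reasoning
    N = fromℕ (suc n)

  -- The Lipschitz constant `n / (n + 1)`, with the denominator multiplied out.
  contraction-rate : ∀ n x y → fromℕ (suc n) * ∥ T n x -ᴹ T n y ∥ ≤ fromℕ n * ∥ x -ᴹ y ∥
  contraction-rate n x y = ≤-trans
    (scaled-∥∥-≤ (fromℕ-nonneg n) (contraction-step n x y))
    (*-monoʳ-≤-nonneg (fromℕ-nonneg n) (U-nonexpansive x y))

  -- For a fixed point the cleared equation reads `(n + 1) x = n U x + v₀`; moving `n x` and `v₀`
  -- across gives the relation `y n = n z n`.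
  fixed-point-displacement : ∀ n {x} → IsFixedPoint X (T n) x → x -ᴹ v₀ ≈ᴹ fromℕ n *ₗ (U x -ᴹ x)
  fixed-point-displacement n {x} Tx≈x = E.begin
    x -ᴹ v₀                          E.≈⟨ x+w≈z+y⇒x-y≈z-w x+nx≈nUx+v₀ ⟩
    fromℕ n *ₗ U x -ᴹ fromℕ n *ₗ x   E.≈⟨ *ₗ-distrib-ᴹ (fromℕ n) (U x) x ⟨
    fromℕ n *ₗ (U x -ᴹ x)            E.∎
    where
    module E = ≈ᴹ-Reasoning
    x+nx≈nUx+v₀ : x +ᴹ fromℕ n *ₗ x ≈ᴹ fromℕ n *ₗ U x +ᴹ v₀
    x+nx≈nUx+v₀ = E.begin
      x +ᴹ fromℕ n *ₗ x         E.≈⟨ +ᴹ-congʳ (*ₗ-identityˡ x) ⟨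
      1# *ₗ x +ᴹ fromℕ n *ₗ x   E.≈⟨ *ₗ-distribʳ x 1# (fromℕ n) ⟨
      fromℕ (suc n) *ₗ x        E.≈⟨ *ₗ-congˡ Tx≈x ⟨
      fromℕ (suc n) *ₗ T n x    E.≈⟨ [1+n]T≈nU+v₀ n x ⟩
      fromℕ n *ₗ U x +ᴹ v₀      E.∎

  -- The second argument regroups as `(U x - U y) - (x - y)`, and `U x - U y` is no longer than
  -- `x - y`, which is the situation of `⟨x,y-x⟩≤0`.
  U-id-monotone : ∀ x y → ⟨ x -ᴹ y , (U x -ᴹ x) -ᴹ (U y -ᴹ y) ⟩ ≤ 0#
  U-id-monotone x y = ≤-trans
    (≤-reflexive (⟨⟩-cong ≈ᴹ-refl ([x-y]-[z-w]≈[x-z]-[y-w] (U x) x (U y) y)))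
    (⟨x,y-x⟩≤0 (U-nonexpansive x y))

  -- The geometric rate `(n / (n + 1))^j` is weakened to `n / (n + j)`, which still tends to zero
  -- and needs no powers. The induction rests on `(n + j + 1) n + j = (n + 1)(n + j)`.
  iterate-distance : ∀ n {x} y → IsFixedPoint X (T n) x → ∀ j →
    fromℕ (n ℕ.+ j) * ∥ x -ᴹ fold y (T n) j ∥ ≤ fromℕ n * ∥ x -ᴹ y ∥
  iterate-distance n {x} y Tx≈x zero =
    ≤-reflexive (*-congʳ (reflexive (≡.cong fromℕ (ℕ.+-identityʳ n))))
  iterate-distance n {x} y Tx≈x (suc j) = *-cancelˡ-≤-pos (0<fromℕ-suc n) (begin
    N * (fromℕ (n ℕ.+ suc j) * d′)     ≡⟨ ≡.cong (λ i → N * (fromℕ i * d′)) (ℕ.+-suc n j) ⟩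
    N * (fromℕ (suc (n ℕ.+ j)) * d′)
      ≈⟨ solve 3 (λ a b c → a :* (b :* c) := b :* (a :* c)) refl N _ d′ ⟩
    (1# + fromℕ (n ℕ.+ j)) * (N * d′)  ≤⟨ *-monoʳ-≤-nonneg (fromℕ-nonneg (suc (n ℕ.+ j))) Nd′≤nd ⟩
    (1# + fromℕ (n ℕ.+ j)) * (fromℕ n * d) ≈⟨ *-congʳ (+-congˡ (fromℕ-+ n j)) ⟩
    (1# + (fromℕ n + fromℕ j)) * (fromℕ n * d) ≈⟨ +-identityʳ _ ⟨
    (1# + (fromℕ n + fromℕ j)) * (fromℕ n * d) + 0#
      ≤⟨ +-monoʳ-≤ _ (*-nonneg (fromℕ-nonneg j) (∥∥-nonneg _)) ⟩
    -- The solver sees `1#` as a variable `e`; the factor `1#` put on the extra term makes the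
    -- identity hold for every `e`.
    (1# + (fromℕ n + fromℕ j)) * (fromℕ n * d) + fromℕ j * d ≈⟨ +-congˡ (*-identityˡ _) ⟨
    (1# + (fromℕ n + fromℕ j)) * (fromℕ n * d) + 1# * (fromℕ j * d)
      ≈⟨ solve 4 (λ e n j d → (e :+ (n :+ j)) :* (n :* d) :+ e :* (j :* d) := (e :+ n) :* ((n :+ j) :* d)) refl 1# (fromℕ n) (fromℕ j) d ⟩
    N * ((fromℕ n + fromℕ j) * d)      ≈⟨ *-congˡ (*-congʳ (fromℕ-+ n j)) ⟨
    N * (fromℕ (n ℕ.+ j) * d)
      ≤⟨ *-monoʳ-≤-nonneg (fromℕ-nonneg (suc n)) (iterate-distance n y Tx≈x j) ⟩
    N * (fromℕ n * ∥ x -ᴹ y ∥)         ∎)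
    where
    N = fromℕ (suc n)
    d = ∥ x -ᴹ fold y (T n) j ∥
    d′ = ∥ x -ᴹ fold y (T n) (suc j) ∥
    Nd′≤nd : N * d′ ≤ fromℕ n * d
    Nd′≤nd =
      ≤-trans (*-monoʳ-≤-nonneg (fromℕ-nonneg (suc n)) (∥∥-cong (+ᴹ-congʳ (≈ᴹ-sym Tx≈x)))) (contraction-rate n x _)

  -- The iterates of `T n` from `v₀` stay in `C` by convexity and approach `x`, so closedness
  -- applies. This places every `u n` in `C`, where the diameter bounds its distance to `v₀`.
  fixed-point-in-closed : ∀ {p} {C : Pred Carrierᴹ p} → Closed X C → Convex X C →
    (∀ x → x ∈ C → U x ∈ C) → v₀ ∈ C → ∀ n {x} → IsFixedPoint X (T n) x → x ∈ C
  fixed-point-in-closed {C = C} closed convex U∈C v₀∈C n {x} Tx≈x = closed x approximation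
    where
    iterates∈C : ∀ j → fold v₀ (T n) j ∈ C
    iterates∈C zero    = v₀∈C
    iterates∈C (suc j) = convex _ _ _ (U∈C _ (iterates∈C j)) v₀∈C (<⇒≤ (0<1/suc n)) (1/suc≤1 n)

    bound = archimedean (fromℕ n * ∥ x -ᴹ v₀ ∥)
    M = proj₁ bound

    0<M : 0# < fromℕ M
    0<M = ≤-<-trans (*-nonneg (fromℕ-nonneg n) (∥∥-nonneg _)) (proj₂ bound)

    approximation : ∀ k → ∃[ y ] (y ∈ C × ∥ x -ᴹ y ∥ < 1/suc k)
    approximation k =
      fold v₀ (T n) j , iterates∈C j , *-cancelˡ-<-pos (*-pos 0<M (0<fromℕ-suc k)) (begin-strict
      fromℕ M * fromℕ (suc k) * d        ≈⟨ *-congʳ (fromℕ-* M (suc k)) ⟨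
      fromℕ j * d                        ≈⟨ +-identityˡ _ ⟨
      0# + fromℕ j * d                   ≤⟨ +-monoˡ-≤ _ (*-nonneg (fromℕ-nonneg n) (∥∥-nonneg _)) ⟩
      fromℕ n * d + fromℕ j * d
        ≈⟨ trans (*-congʳ (fromℕ-+ n j)) (distribʳ d (fromℕ n) (fromℕ j)) ⟨
      fromℕ (n ℕ.+ j) * d                ≤⟨ iterate-distance n v₀ Tx≈x j ⟩
      fromℕ n * ∥ x -ᴹ v₀ ∥              <⟨ proj₂ bound ⟩
      fromℕ M                            ≈⟨ *-identityʳ _ ⟨
      fromℕ M * 1#                       ≈⟨ *-congˡ (fromℕ-suc*1/suc k) ⟨
      fromℕ M * (fromℕ (suc k) * 1/suc k) ≈⟨ *-assoc _ _ _ ⟨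
      fromℕ M * fromℕ (suc k) * 1/suc k  ∎)
      where
      -- Chosen so that `M (k + 1) d ≤ (n + j) d ≤ n ∥ x -ᴹ v₀ ∥ < M`, hence `d < 1/(k + 1)`.
      j = M ℕ.* suc k
      d = ∥ x -ᴹ fold v₀ (T n) j ∥

  -- Distances along the path.

  module _ (u : ℕ → Carrierᴹ) (u-fixed : ∀ n → IsFixedPoint X (T n) (u n)) where

    -- `path-increment` cancels the difference of the two indices and so requires `i < j`; for equal
    -- indices both sides vanish.
    path-distance : ∀ {i j} → i ℕ.≤ j → (u i -ᴹ u j) ² ≤ (u j -ᴹ v₀) ² - (u i -ᴹ v₀) ²
    path-distance {i} {j} i≤j with ℕ.m≤n⇒m<n∨m≡n i≤j
    ... | inj₂ ≡.refl = ≤-reflexive (trans (x≈0⇒x²≈0 (-ᴹ‿inverseʳ (u i))) (sym (-‿inverseʳ _)))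
    ... | inj₁ i<j    = begin
      (u i -ᴹ u j) ²                    ≈⟨ ²-cong differences ⟨
      ((u i -ᴹ v₀) -ᴹ (u j -ᴹ v₀)) ²    ≤⟨ path-increment (fromℕ-nonneg i) (fromℕ-mono-< i<j)
                                             (fixed-point-displacement i (u-fixed i))
                                             (fixed-point-displacement j (u-fixed j))
                                             (≤-trans (≤-reflexive (⟨⟩-cong differences ≈ᴹ-refl)) (U-id-monotone (u i) (u j))) ⟩
      (u j -ᴹ v₀) ² - (u i -ᴹ v₀) ²     ∎
      where
      differences = [x-z]-[y-z]≈x-y (u i) (u j) v₀

    ∥u-v₀∥²-monotone : ∀ {i j} → i ℕ.≤ j → (u i -ᴹ v₀) ² ≤ (u j -ᴹ v₀) ²
    ∥u-v₀∥²-monotone i≤j = 0≤y-x⇒x≤y (≤-trans (⟨⟩-nonneg _) (path-distance i≤j))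

    ∥u-v₀∥²-gap : ∀ {N i j M} → N ℕ.≤ i → j ℕ.≤ M →
      (u j -ᴹ v₀) ² - (u i -ᴹ v₀) ² ≤ (u M -ᴹ v₀) ² - (u N -ᴹ v₀) ²
    ∥u-v₀∥²-gap N≤i j≤M = +-mono-≤ (∥u-v₀∥²-monotone j≤M) (-‿anti-mono-≤ (∥u-v₀∥²-monotone N≤i))

    path-distance-symmetric : ∀ {N i j M} → N ℕ.≤ i → i ℕ.≤ M → N ℕ.≤ j → j ℕ.≤ M →
      (u i -ᴹ u j) ² ≤ (u M -ᴹ v₀) ² - (u N -ᴹ v₀) ²
    path-distance-symmetric {N} {i} {j} {M} N≤i i≤M N≤j j≤M with ℕ.≤-total i j
    ... | inj₁ i≤j = ≤-trans (path-distance i≤j) (∥u-v₀∥²-gap N≤i j≤M)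
    ... | inj₂ j≤i =
      ≤-trans (≤-reflexive (²-swap (u i) (u j))) (≤-trans (path-distance j≤i) (∥u-v₀∥²-gap N≤j i≤M))

-- Natural-number estimates for `h`, `R` and `φ`.

open import Data.Nat.Base using (_≤_)

b²[1+K]≡b²K+b² : ∀ b k → b ℕ.* b ℕ.* suc (suc k ℕ.* suc k) ≡ b ℕ.* b ℕ.* (suc k ℕ.* suc k) ℕ.+ b ℕ.* b
b²[1+K]≡b²K+b² = solve-∀

-- Powers are written as the products they unfold to: the solver does not read _^_.
b²K*64b²K+b²≡R : ∀ b k →
  b ℕ.* b ℕ.* (suc k ℕ.* suc k) ℕ.* (64 ℕ.* (b ℕ.* b ℕ.* (suc k ℕ.* suc k))) ℕ.+ b ℕ.* b ≡
  64 ℕ.* (b ℕ.* (b ℕ.* (b ℕ.* (b ℕ.* 1)))) ℕ.*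
    ((k ℕ.+ 1) ℕ.* ((k ℕ.+ 1) ℕ.* ((k ℕ.+ 1) ℕ.* ((k ℕ.+ 1) ℕ.* 1)))) ℕ.+ b ℕ.* (b ℕ.* 1)
b²K*64b²K+b²≡R = solve-∀

module BoundProperties (b k : ℕ) .{{_ : ℕ.NonZero b}} (f : ℕ → ℕ) (f-mono : Monotonic₁ _≤_ _≤_ f) where
  open Bound b k f
  open import Data.Nat.Base using (_+_; _*_; _^_; _<_; NonZero)
  open ℕ.≤-Reasoning

  n≤c[n+1]² : ∀ c .{{_ : NonZero c}} n → n ≤ c * (n + 1) ^ 2
  n≤c[n+1]² c n = begin
    n                ≤⟨ ℕ.m≤m+n n 1 ⟩
    n + 1            ≤⟨ ℕ.m≤m*n (n + 1) ((n + 1) ^ 1) {{ℕ.m^n≢0 (n + 1) 1 {{n+1≢0}}}} ⟩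
    (n + 1) ^ 2      ≤⟨ ℕ.m≤n*m ((n + 1) ^ 2) c ⟩
    c * (n + 1) ^ 2  ∎
    where
    n+1≢0 : NonZero (n + 1)
    n+1≢0 = ℕ.>-nonZero (ℕ.m≤n+m 1 n)

  n≤12b²[n+1]²+b : ∀ n → n ≤ 12 * b ^ 2 * (n + 1) ^ 2 + b
  n≤12b²[n+1]²+b n = ℕ.≤-trans
    (n≤c[n+1]² (12 * b ^ 2) {{ℕ.m*n≢0 12 (b ^ 2) {{_}} {{ℕ.m^n≢0 b 2}}}} n) (ℕ.m≤m+n _ b)

  n≤h[n] : ∀ n → n ≤ h n
  n≤h[n] n = ℕ.≤-trans (n≤c[n+1]² (12 * b) {{ℕ.m*n≢0 12 b}} n)
    (ℕ.≤-trans (ℕ.m≤n⊔m _ _) (ℕ.m≤m+n _ 1))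

  -- Inside `h` the function `f` is evaluated at a point that dominates `n`, and the remaining
  -- factors are at least 1. Hence the interval from `n` to `f n` lies within the one from `n` to
  -- `h n`.
  f[n]≤h[n] : ∀ n → f n ≤ h n
  f[n]≤h[n] n = begin
    f n                               ≤⟨ f-mono (n≤12b²[n+1]²+b n) ⟩
    f M                               ≤⟨ ℕ.m≤m+n (f M) 1 ⟩
    f M + 1                           ≤⟨ ℕ.m≤n*m (f M + 1) (8 * b) {{ℕ.m*n≢0 8 b}} ⟩
    8 * b * (f M + 1)
      ≤⟨ ℕ.m≤m*n _ ((k + 1) ^ 2) {{ℕ.m^n≢0 (k + 1) 2 {{ℕ.>-nonZero (ℕ.m≤n+m 1 k)}}}} ⟩
    8 * b * (f M + 1) * (k + 1) ^ 2   ≤⟨ ℕ.m≤m⊔n _ _ ⟩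
    _                                 ≤⟨ ℕ.m≤m+n _ 1 ⟩
    h n                               ∎
    where M = 12 * b ^ 2 * (n + 1) ^ 2 + b

  iterates-monotone : ∀ {i j} → i ℕ.≤′ j → fold 0 h i ≤ fold 0 h j
  iterates-monotone ℕ.≤′-refl       = ℕ.≤-refl
  iterates-monotone (ℕ.≤′-step i≤j) = ℕ.≤-trans (iterates-monotone i≤j) (n≤h[n] _)

  -- The iterates of `h` increase, and `φ` applies to the `R`-th one the map `12b²(n + 1)² + b`,
  -- which dominates the identity.
  iterate≤φ : ∀ {i} → i ≤ R → fold 0 h i ≤ φ
  iterate≤φ {i} i≤R = begin
    fold 0 h i        ≤⟨ iterates-monotone (ℕ.≤⇒≤′ i≤R) ⟩
    -- `fold` is used in the proof because `fold 0 h (suc i)` reduces to `h (fold 0 h i)`; `φ` is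
    -- stated with `iterate`.
    fold 0 h R        ≡⟨ iterate-is-fold 0 h R ⟩
    _                 ≤⟨ n≤12b²[n+1]²+b _ ⟩
    φ                 ∎

  -- With `x = b²(k + 1)²` the left side is `x + b²` and `R` is `x · 64x + b²`, so `x ≥ 1` is
  -- enough.
  b²[1+[k+1]²]<R : b * b * suc (suc k * suc k) < R
  b²[1+[k+1]²]<R = begin-strict
    b * b * suc (suc k * suc k)             ≡⟨ b²[1+K]≡b²K+b² b k ⟩
    x + b * b
      <⟨ ℕ.+-monoˡ-< (b * b) (ℕ.m<m*n x (64 * x) {{x≢0}} (ℕ.≤-trans (ℕ.s≤s (ℕ.s≤s ℕ.z≤n)) (ℕ.m≤m*n 64 x {{x≢0}}))) ⟩
    x * (64 * x) + b * b                    ≡⟨ b²K*64b²K+b²≡R b k ⟩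
    R                                       ∎
    where
    x = b * b * (suc k * suc k)
    x≢0 : NonZero x
    x≢0 = ℕ.m*n≢0 (b * b) (suc k * suc k) {{ℕ.m*n≢0 b b}}

-- The path estimate combined with the pigeonhole along the iterates of `h`.

theorem5p3 :
    ∀ {c ℓ₁ ℓ₂ m ℓm p} (ℝ : RealNumbers c ℓ₁ ℓ₂) (X : HilbertSpace ℝ m ℓm) →
    let module ℝ = RealNumbers ℝ
        open HilbertSpace X
    in
    (U : Carrierᴹ → Carrierᴹ) → Nonexpansive X U →
    (C : Pred Carrierᴹ p) → Bounded X C → Closed X C → Convex X C →
    (∀ x → x ∈ C → U x ∈ C) →
    (v₀ : Carrierᴹ) → v₀ ∈ C →
    (u : ℕ → Carrierᴹ) → (∀ n → IsFixedPoint X (contraction X U v₀ n) (u n)) →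
    (b : ℕ) → 1 ≤ b → DiameterAtMost X b C →
    (k : ℕ) (f : ℕ → ℕ) → Monotonic₁ _≤_ _≤_ f →
    ∃[ N ] (N ≤ Bound.φ b k f ×
            (∀ i j → N ≤ i → i ≤ f N → N ≤ j → j ≤ f N →
               ∥ u i -ᴹ u j ∥ ℝ.< ℝ.1/suc k))
theorem5p3 ℝ X U U-nonexpansive C _ closed convex U∈C v₀ v₀∈C u u-fixed b 1≤b diameter≤b k f f-mono
  = N , iterate≤φ (ℕ.<⇒≤ (proj₁ (proj₂ small))) , close
  where
  open RealNumbers ℝ using (orderedField)
  open OrderedField orderedField hiding (_≤_)
  open OrderedFieldProperties orderedField
  open HilbertSpace X
  open HilbertSpaceProperties X
  open NonexpansivePath X U U-nonexpansive v₀
  open BoundProperties b k {{ℕ.>-nonZero 1≤b}} f f-mono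
  open Bound b k f
  open ≤-Reasoning

  -- This is `1/((k + 1)² + 1)`, strictly below the target `1/(k + 1)²` for squared distances.
  δ = 1/suc (suc k ℕ.* suc k)

  s : ℕ → Carrier
  s i = (u (fold 0 h i) -ᴹ v₀) ²

  s[R]<Rδ : s R < fromℕ R * δ
  s[R]<Rδ = begin-strict
    s R                                  ≈⟨ ∥∥-square w ⟨
    ∥ w ∥ * ∥ w ∥
      ≤⟨ *-mono-square-≤ (∥∥-nonneg w) (diameter≤b _ v₀ (fixed-point-in-closed closed convex U∈C v₀∈C n (u-fixed n)) v₀∈C) ⟩
    fromℕ b * fromℕ b                    ≈⟨ fromℕ-* b b ⟨
    fromℕ (b ℕ.* b)                      ≈⟨ *-identityʳ _ ⟨
    -- Writing 1 as `(K + 1) δ` turns the bound `b²` into a multiple of `δ` with natural coefficient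
    -- `b²(K + 1)`, which is below `R`.
    fromℕ (b ℕ.* b) * 1#                 ≈⟨ *-congˡ (fromℕ-suc*1/suc K) ⟨
    fromℕ (b ℕ.* b) * (fromℕ (suc K) * δ) ≈⟨ *-assoc _ _ _ ⟨
    fromℕ (b ℕ.* b) * fromℕ (suc K) * δ  ≈⟨ *-congʳ (fromℕ-* (b ℕ.* b) (suc K)) ⟨
    fromℕ (b ℕ.* b ℕ.* suc K) * δ        ≈⟨ *-comm _ δ ⟩
    δ * fromℕ (b ℕ.* b ℕ.* suc K)
      <⟨ *-monoʳ-<-pos (0<1/suc K) (fromℕ-mono-< b²[1+[k+1]²]<R) ⟩
    δ * fromℕ R                          ≈⟨ *-comm δ _ ⟩
    fromℕ R * δ                          ∎
    where
    K = suc k ℕ.* suc k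
    n = fold 0 h R
    w = u n -ᴹ v₀

  small : ∃[ i ] (i ℕ.< R × s (suc i) - s i < 1/suc k * 1/suc k)
  small = small-increment (1/suc[suck²]<[1/suck]² k) s (⟨⟩-nonneg _) R s[R]<Rδ

  N : ℕ
  N = fold 0 h (proj₁ small)

  close : ∀ i j → N ≤ i → i ≤ f N → N ≤ j → j ≤ f N → ∥ u i -ᴹ u j ∥ < 1/suc k
  close i j N≤i i≤fN N≤j j≤fN = x²<y²⇒x<y (∥∥-nonneg _) (0<1/suc k) (begin-strict
    ∥ u i -ᴹ u j ∥ * ∥ u i -ᴹ u j ∥       ≈⟨ ∥∥-square _ ⟩
    (u i -ᴹ u j) ²
      ≤⟨ path-distance-symmetric u u-fixed N≤i (below i≤fN) N≤j (below j≤fN) ⟩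
    -- The upper endpoint of the path estimate is `h N`, and `u (h N)` is by definition the next
    -- term sampled by `s`, so the gap is exactly the small increment.
    s (suc (proj₁ small)) - s (proj₁ small) <⟨ proj₂ (proj₂ small) ⟩
    1/suc k * 1/suc k                     ∎)
    where
    below : ∀ {n} → n ≤ f N → n ≤ h N
    below n≤fN = ℕ.≤-trans n≤fN (f[n]≤h[n] N)
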